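{- Let $D$ be a finite oriented graph whose missing graph is $S_x\cup S_y$, where $S_x$ and $S_y$ are stars with distinct centers $x\neq y$ (the two stars may be vertex-disjoint or may share vertices). Then $D$ has a vertex $v$ with $|N^+(v)|\le |N^{++}(v)|$.
   Context: An oriented graph is a finite digraph with no loops and at most one arc between any two vertices. $N^+(v)$ is the out-neighborhood of $v$, and the second out-neighborhood $N^{++}(v)$ is the set of vertices $w\notin N^+(v)\cup\{v\}$ such that $u\to w$ for some $u\in N^+(v)$. Two distinct vertices $u,v$ form a missing edge $uv$ if neither $(u,v)$ nor $(v,u)$ is an arc. The missing graph of $D$ is the graph whose edges are the missing edges of $D$ and whose vertices are the vertices incident to a missing edge. A star $S_x$ with center $x$ and leaves $a_1,\dots,a_k$ ($k\ge 0$) is the graph with vertex set $\{x,a_1,\dots,a_k\}$ and edges $a_ix$. -}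

module Defs where

open import Data.Fin using (Fin)
open import Data.Fin.Properties using (_≟_; any?)
open import Data.Fin.Subset using (Subset; _∈_; _∉_)
open import Data.Nat using (ℕ)
open import Data.Product using (∃-syntax; _×_; _,_)
open import Data.Sum using (_⊎_; inj₁; inj₂; [_,_]; map)
open import Data.Vec using (tabulate)
open import Level using (0ℓ)
open import Relation.Binary.Core using (Rel; _⇔_)
open import Relation.Binary.Definitions
  using (Irreflexive; Asymmetric; Symmetric; Decidable)
open import Relation.Binary.PropositionalEquality using (_≡_; _≢_; refl; ≢-sym)
open import Relation.Nullary using (¬_; does; ¬?; _×-dec_)
import Relation.Unary as U

record OrientedGraph (n : ℕ) : Set₁ where
  infix 4 _⟶_ _⟶?_
  field
    _⟶_    : Rel (Fin n) 0ℓ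
    _⟶?_   : Decidable _⟶_
    irrefl : Irreflexive _≡_ _⟶_
    asym   : Asymmetric _⟶_

-- Simple graphs whose vertices are drawn from Fin n, but need not be all of it.
record Graph (n : ℕ) : Set₁ where
  field
    Vertex   : U.Pred (Fin n) 0ℓ
    Edge     : Rel (Fin n) 0ℓ
    irrefl   : Irreflexive _≡_ Edge
    sym      : Symmetric Edge
    incident : ∀ {u v} → Edge u v → Vertex u

infix 4 _≐_
_≐_ : ∀ {n} → Graph n → Graph n → Set
G ≐ H = (G.Vertex U.≐ H.Vertex) × (G.Edge ⇔ H.Edge)
  where
  module G = Graph G
  module H = Graph H

infixr 6 _∪_
_∪_ : ∀ {n} → Graph n → Graph n → Graph n
G ∪ H = record
  { Vertex   = G.Vertex U.∪ H.Vertex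
  ; Edge     = λ u v → G.Edge u v ⊎ H.Edge u v
  ; irrefl   = λ u≡v → [ G.irrefl u≡v , H.irrefl u≡v ]
  ; sym      = map G.sym H.sym
  ; incident = map G.incident H.incident
  }
  where
  module G = Graph G
  module H = Graph H

-- L may be empty; being a set, it makes the leaves distinct.
star : ∀ {n} (x : Fin n) (L : Subset n) → x ∉ L → Graph n
star {n} x L x∉L = record
  { Vertex   = λ v → v ≡ x ⊎ v ∈ L
  ; Edge     = E
  ; irrefl   = λ { refl (inj₁ (refl , x∈L)) → x∉L x∈L
                 ; refl (inj₂ (x∈L , refl)) → x∉L x∈L }
  ; sym      = λ { (inj₁ (p , q)) → inj₂ (q , p) ; (inj₂ (p , q)) → inj₁ (q , p) }
  ; incident = λ { (inj₁ (p , _)) → inj₁ p ; (inj₂ (p , _)) → inj₂ p }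
  }
  where
  E : Rel (Fin n) 0ℓ
  E u v = (u ≡ x × v ∈ L) ⊎ (u ∈ L × v ≡ x)

module _ {n : ℕ} (D : OrientedGraph n) where
  open OrientedGraph D

  Missing : Rel (Fin n) 0ℓ
  Missing u v = u ≢ v × ¬ (u ⟶ v) × ¬ (v ⟶ u)

  missingGraph : Graph n
  missingGraph = record
    { Vertex   = λ v → ∃[ u ] Missing v u
    ; Edge     = Missing
    ; irrefl   = λ u≡v (u≢v , _) → u≢v u≡v
    ; sym      = λ (u≢v , ¬uv , ¬vu) → ≢-sym u≢v , ¬vu , ¬uv
    ; incident = λ {_} {v} uv → v , uv
    }

  SecondOut : Rel (Fin n) 0ℓ
  SecondOut v w = ¬ (v ⟶ w) × w ≢ v × ∃[ u ] (v ⟶ u × u ⟶ w)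

  secondOut? : Decidable SecondOut
  secondOut? v w =
    ¬? (v ⟶? w) ×-dec ¬? (w ≟ v) ×-dec any? (λ u → (v ⟶? u) ×-dec (u ⟶? w))

  N⁺ : Fin n → Subset n
  N⁺ v = tabulate (λ w → does (v ⟶? w))

  N⁺⁺ : Fin n → Subset n
  N⁺⁺ v = tabulate (λ w → does (secondOut? v w))

-- Insert one arc for every missing edge and take an order of the vertices with the most forward arcs
-- (a median order).  Its last vertex f is a Havet–Thomassé vertex of the resulting tournament, so f can
-- only fail in D if an inserted arc u ⟶ w is offended by f: f ⟶ u, but w is not within distance two of f.
-- Offenders of the two orientations of a missing edge uw themselves span a missing edge disjoint from uw,
-- so orientations can be chosen whose only offenders are the centres x and y, each of them losing a single
-- vertex, except for the following.
--   * x and y not adjacent: none.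
--   * x ⟶ y, and some v ≠ y offends some a ⟶ x: x may lose several vertices, but x ⟶ v and x dominates all
--     that v dominates, so x is never last.
--   * x ⟶ y otherwise: every a ⟶ x is inserted; a leaf a may lose y, but the inserted arc a ⟶ x makes up
--     for it.
-- Losing one vertex is harmless because the Havet–Thomassé inequality at f is strict unless f can be moved
-- forward to obtain a median order that ends in the vertex formerly next to last.
module Submission where

open import Defs
open import Data.Bool using (true; false)
open import Data.Empty using (⊥; ⊥-elim)
open import Data.Fin as Fin using (Fin; zero; suc)
open import Data.Fin.Properties using (_≟_; any?; all?; <-cmp; <-asym; _<?_)
open import Data.Fin.Subset using (Subset; _∈_; _∉_; ∣_∣; ⁅_⁆)
  renaming (_∪_ to _∪ₛ_)
open import Data.Fin.Subset.Properties
  using (_∈?_; drop-there; ∣⁅x⁆∣≡1; x∈p∪q⁻; x∈p∪q⁺; x∈⁅y⁆⇒x≡y; x∈⁅x⁆; p⊆p∪q; p⊂q⇒∣p∣<∣q∣)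
open import Data.List
  using (List; []; _∷_; _++_; _∷ʳ_; [_]; filter; length; allFin; map; tabulate; initLast; InitLast; _∷ʳ′_)
open import Data.List.Membership.Propositional.Properties using (∈-allFin; ∈-∃++; ∈-++⁻)
open import Data.List.Properties
  using (++-assoc; ++-identityʳ; ∷ʳ-injective; filter-none; filter-all; filter-++; length-filter; length-++; map-tabulate)
open import Data.List.Relation.Binary.Permutation.Propositional using (_↭_; ↭-refl; ↭-sym; ↭-trans)
open import Data.List.Relation.Binary.Permutation.Propositional.Properties
  using (∈-resp-↭; ↭-length; filter-↭; ++⁺ˡ; shift)
open import Data.List.Relation.Unary.All as All using (All; []; _∷_)
open import Data.List.Relation.Unary.Any using (here)
import Data.List.Relation.Unary.All.Properties as All
open import Data.Nat using (ℕ; zero; suc; _+_; _*_; _≤_; _<_; z≤n; s≤s)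
open import Data.Nat.Properties hiding (_≟_; <-cmp; <-asym; _<?_)
open import Data.Nat.Tactic.RingSolver using (solve-∀)
open import Data.Product using (∃-syntax; _×_; _,_; proj₁; proj₂)
open import Data.Sum using (_⊎_; inj₁; inj₂; fromInj₁; swap; [_,_]′)
open import Data.Vec as Vec using ([]; _∷_; here; there)
open import Data.Vec.Properties using (lookup⇒[]=; []=⇒lookup; lookup∘tabulate)
open import Function using (_∘_)
open import Level using (0ℓ)
open import Relation.Binary.Core using (Rel)
import Relation.Binary.Definitions as B
open B using (tri<; tri≈; tri>)
open import Relation.Binary.PropositionalEquality using (_≡_; _≢_; refl; sym; trans; cong; subst; subst₂; ≢-sym)
open import Relation.Nullary using (¬_; Dec; yes; no; does; ¬?; _×-dec_; _⊎-dec_; _→-dec_; contradiction)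
open import Relation.Nullary.Decidable using (dec-true; decidable-stable)
open import Relation.Unary using (Pred; Decidable)

private variable
  n : ℕ
  V A : Set

-- Extremal arguments by contradiction.

no-minimum⇒empty : {P : Pred A 0ℓ} (φ : A → ℕ) →
  (∀ a → P a → (∀ b → P b → φ a ≤ φ b) → ⊥) → ∀ a → ¬ P a
no-minimum⇒empty {P = P} φ step a = below (suc (φ a)) a (n<1+n (φ a))
  where
  below : ∀ k a → φ a < k → ¬ P a
  below (suc k) a (s≤s φa≤k) Pa =
    step a Pa λ b Pb → ≮⇒≥ λ φb<φa → below k b (<-≤-trans φb<φa φa≤k) Pb

-- `k` bounds how often φ can still grow before it exceeds `m`. With `P` undecided no maximizer is
-- computed; every candidate is refuted instead.
no-maximum⇒empty : {P : Pred A 0ℓ} (φ : A → ℕ) (m : ℕ) → (∀ a → P a → φ a ≤ m) →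
  (∀ a → P a → (∀ b → P b → φ b ≤ φ a) → ⊥) → ∀ a → ¬ P a
no-maximum⇒empty {P = P} φ m φ≤m step a = above (suc m) a (m≤n+m (suc m) (φ a))
  where
  above : ∀ k a → m < φ a + k → ¬ P a
  above zero    a m<φa Pa = <⇒≱ (subst (m <_) (+-identityʳ (φ a)) m<φa) (φ≤m a Pa)
  above (suc k) a m<φa+1+k Pa = step a Pa λ b Pb → ≮⇒≥ λ φa<φb →
    above k b (<-≤-trans m<φa+1+k (≤-trans (≤-reflexive (+-suc (φ a) k)) (+-monoˡ-≤ k φa<φb))) Pb

-- Counting along lists.

count : {P : Pred V 0ℓ} → Decidable P → List V → ℕ
count P? xs = length (filter P? xs)

count-++ : {P : Pred V 0ℓ} (P? : Decidable P) (xs ys : List V) → count P? (xs ++ ys) ≡ count P? xs + count P? ys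
count-++ P? xs ys = trans (cong length (filter-++ P? xs ys)) (length-++ (filter P? xs))

count-↭ : {P : Pred V 0ℓ} (P? : Decidable P) {xs ys : List V} → xs ↭ ys → count P? xs ≡ count P? ys
count-↭ P? = ↭-length ∘ filter-↭ P?

count-mono : {P Q : Pred V 0ℓ} (P? : Decidable P) (Q? : Decidable Q) {xs : List V} →
  All (λ x → P x → Q x) xs → count P? xs ≤ count Q? xs
count-mono P? Q? [] = z≤n
count-mono P? Q? {x ∷ xs} (P→Q ∷ rest) with P? x | Q? x
... | yes _ | yes _ = s≤s (count-mono P? Q? rest)
... | yes p | no ¬q = contradiction (P→Q p) ¬q
... | no  _ | yes _ = m≤n⇒m≤1+n (count-mono P? Q? rest)
... | no  _ | no  _ = count-mono P? Q? rest

count-∷⁺ : {P : Pred V 0ℓ} (P? : Decidable P) {x : V} {xs : List V} → P x → count P? (x ∷ xs) ≡ suc (count P? xs)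
count-∷⁺ P? {x} p with P? x
... | yes _ = refl
... | no ¬p = contradiction p ¬p

count-∷⁻ : {P : Pred V 0ℓ} (P? : Decidable P) {x : V} {xs : List V} → ¬ P x → count P? (x ∷ xs) ≡ count P? xs
count-∷⁻ P? {x} ¬p with P? x
... | yes p = contradiction p ¬p
... | no _  = refl

count-map : {P : Pred V 0ℓ} (f : A → V) (P? : Decidable P) (P′? : Decidable (P ∘ f)) (xs : List A) →
  count P? (map f xs) ≡ count P′? xs
count-map f P? P′? [] = refl
count-map f P? P′? (x ∷ xs) with P? (f x) | P′? x
... | yes _ | yes _ = cong suc (count-map f P? P′? xs)
... | no _  | no _  = count-map f P? P′? xs
... | yes p | no ¬p = contradiction p ¬p
... | no ¬p | yes p = contradiction p ¬p

count-cong : {P Q : Pred V 0ℓ} (P? : Decidable P) (Q? : Decidable Q) {xs : List V} →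
  (∀ {x} → P x → Q x) → (∀ {x} → Q x → P x) → count P? xs ≡ count Q? xs
count-cong P? Q? {xs} P→Q Q→P = ≤-antisym
  (count-mono P? Q? {xs} (All.universal (λ _ → P→Q) xs))
  (count-mono Q? P? {xs} (All.universal (λ _ → Q→P) xs))

count-∈-tail : ∀ b (p : Subset n) → count (_∈? (b ∷ p)) (tabulate suc) ≡ count (_∈? p) (allFin n)
count-∈-tail {n} b p = trans
  (cong (count (_∈? (b ∷ p))) (sym (map-tabulate (λ i → i) suc)))
  (trans (count-map suc (_∈? (b ∷ p)) (λ i → suc i ∈? (b ∷ p)) (allFin n))
         (count-cong _ (_∈? p) {allFin n} drop-there there))

count-∈-allFin : (p : Subset n) → count (_∈? p) (allFin n) ≡ ∣ p ∣
count-∈-allFin []          = refl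
count-∈-allFin (true  ∷ p) = cong suc (trans (count-∈-tail true p) (count-∈-allFin p))
count-∈-allFin (false ∷ p) = trans (count-∈-tail false p) (count-∈-allFin p)

-- Forward arcs of an order.

module _ {R : Rel V 0ℓ} (R? : B.Decidable R) where

  outdeg : V → List V → ℕ
  outdeg v = count (R? v)

  indeg : V → List V → ℕ
  indeg v = count (λ u → R? u v)

  forward : List V → ℕ
  forward []      = 0
  forward (v ∷ L) = outdeg v L + forward L

  forward-insert : ∀ pre v post →
    forward (pre ++ v ∷ post) ≡ indeg v pre + outdeg v post + forward (pre ++ post)
  forward-insert []        v post = refl
  forward-insert (u ∷ pre) v post
    rewrite forward-insert pre v post
          | count-++ (R? u) pre (v ∷ post)
          | count-++ (R? u) pre post
    with R? u v
  ... | yes _ = rearrange (outdeg u pre) (outdeg u post) (indeg v pre) (outdeg v post) (forward (pre ++ post))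
    where
    rearrange : ∀ a b c d e → a + suc b + (c + d + e) ≡ suc c + d + (a + b + e)
    rearrange = solve-∀
  ... | no  _ = rearrange (outdeg u pre) (outdeg u post) (indeg v pre) (outdeg v post) (forward (pre ++ post))
    where
    rearrange : ∀ a b c d e → a + b + (c + d + e) ≡ c + d + (a + b + e)
    rearrange = solve-∀

  -- Both orders arise by inserting `v` into `pre ++ seg ++ post`, so they differ only in the arcs
  -- between `v` and `seg`. The additive form avoids truncated subtraction.
  forward-move : ∀ pre seg v post →
    forward (pre ++ seg ++ v ∷ post) + outdeg v seg ≡ forward (pre ++ v ∷ seg ++ post) + indeg v seg
  forward-move pre seg v post
    rewrite sym (++-assoc pre seg (v ∷ post))
          | forward-insert (pre ++ seg) v post
          | forward-insert pre v (seg ++ post)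
          | count-++ (λ u → R? u v) pre seg
          | count-++ (R? v) seg post
          | ++-assoc pre seg post
    = rearrange (indeg v pre) (indeg v seg) (outdeg v post) (forward (pre ++ seg ++ post)) (outdeg v seg)
    where
    rearrange : ∀ a b c d e → a + b + c + d + e ≡ a + (e + c) + d + b
    rearrange = solve-∀

  forward≤length² : ∀ L → forward L ≤ length L * length L
  forward≤length² []      = z≤n
  forward≤length² (v ∷ L) = +-mono-≤ (m≤n⇒m≤1+n (length-filter (R? v) L))
    (≤-trans (forward≤length² L) (*-monoʳ-≤ (length L) (n≤1+n (length L))))

-- Median orders and their feedback property.

count-order : (p : Subset n) {L : List (Fin n)} → L ↭ allFin n → count (_∈? p) L ≡ ∣ p ∣
count-order p L↭ = trans (count-↭ (_∈? p) L↭) (count-∈-allFin p)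

record Median (T : OrientedGraph n) (L : List (Fin n)) : Set where
  open OrientedGraph T
  field
    order   : L ↭ allFin n
    maximal : ∀ L′ → L′ ↭ allFin n → forward _⟶?_ L′ ≤ forward _⟶?_ L

EndsMedian : OrientedGraph n → Fin n → Set
EndsMedian T f = ∃[ M ] Median T (M ∷ʳ f)

module MedianOrders {n : ℕ} (T : OrientedGraph n) where
  open OrientedGraph T

  private
    w  = forward _⟶?_
    d⁺ = outdeg _⟶?_
    d⁻ = indeg _⟶?_

  move-↭ : ∀ (pre seg : List (Fin n)) v post → pre ++ seg ++ v ∷ post ↭ pre ++ v ∷ seg ++ post
  move-↭ pre seg v post = ++⁺ˡ pre (shift v seg post)

  -- The move trades the arcs from `seg` to `v` for those from `v` to `seg`, here without loss, so
  -- the maximum is kept.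
  move-left : ∀ {L} pre seg v post → L ≡ pre ++ seg ++ v ∷ post → Median T L →
    d⁻ v seg ≤ d⁺ v seg → Median T (pre ++ v ∷ seg ++ post)
  move-left pre seg v post refl m in≤out = record
    { order   = ↭-trans (↭-sym (move-↭ pre seg v post)) order
    ; maximal = λ L′ L′↭ → ≤-trans (maximal L′ L′↭) (+-cancelʳ-≤ (d⁻ v seg) _ _
        (≤-trans (+-monoʳ-≤ _ in≤out) (≤-reflexive (forward-move _⟶?_ pre seg v post))))
    }
    where open Median m

  -- Otherwise moving `v` in front of `seg` would gain forward arcs; `feedback⁺` is the mirror
  -- image.
  feedback⁻ : ∀ {L} pre seg v post → L ≡ pre ++ seg ++ v ∷ post → Median T L → d⁺ v seg ≤ d⁻ v seg
  feedback⁻ pre seg v post refl m = +-cancelˡ-≤ (w (pre ++ v ∷ seg ++ post)) _ _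
    (≤-trans (+-monoˡ-≤ (d⁺ v seg) (maximal _ (↭-trans (↭-sym (move-↭ pre seg v post)) order)))
             (≤-reflexive (forward-move _⟶?_ pre seg v post)))
    where open Median m

  feedback⁺ : ∀ {L} pre v seg post → L ≡ pre ++ v ∷ seg ++ post → Median T L → d⁻ v seg ≤ d⁺ v seg
  feedback⁺ pre v seg post refl m = +-cancelˡ-≤ (w (pre ++ v ∷ seg ++ post)) _ _
    (≤-trans (≤-reflexive (sym (forward-move _⟶?_ pre seg v post)))
             (+-monoˡ-≤ (d⁺ v seg) (maximal _ (↭-trans (move-↭ pre seg v post) order))))
    where open Median m

  -- Existence is doubly negated because maximality is not decided; the main argument aims at `⊥`
  -- anyway.
  median-exists : (∀ L → ¬ Median T L) → ⊥
  median-exists none = no-maximum⇒empty {P = _↭ allFin n} w (n′ * n′) bound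
    (λ L L↭ max → none L (record { order = L↭ ; maximal = max })) (allFin n) ↭-refl
    where
    n′ = length (allFin n)
    bound : ∀ L → L ↭ allFin n → w L ≤ n′ * n′
    bound L L↭ = ≤-trans (forward≤length² _⟶?_ L) (≤-reflexive (cong (λ k → k * k) (↭-length L↭)))

  some-vertex-ends : Fin n → (∀ f → ¬ EndsMedian T f) → ⊥
  some-vertex-ends x none = median-exists λ L m → nonempty L m (initLast L)
    where
    nonempty : ∀ L → Median T L → InitLast L → ⊥
    nonempty .[] m [] = contradiction (∈-resp-↭ (↭-sym (Median.order m)) (∈-allFin x)) λ ()
    nonempty .(M ∷ʳ f) m (M ∷ʳ′ f) = none f (M , m)

  last-two-distinct : ∀ M g f → Median T (M ++ g ∷ f ∷ []) → g ≢ f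
  last-two-distinct M g .g m refl = <-irrefl refl (begin-strict
    1                                                    <⟨ ≤-reflexive (sym two) ⟩
    count (_∈? ⁅ g ⁆) (g ∷ g ∷ [])                       ≤⟨ m≤n+m _ _ ⟩
    count (_∈? ⁅ g ⁆) M + count (_∈? ⁅ g ⁆) (g ∷ g ∷ []) ≡⟨ count-++ (_∈? ⁅ g ⁆) M (g ∷ g ∷ []) ⟨
    count (_∈? ⁅ g ⁆) (M ++ g ∷ g ∷ [])                  ≡⟨ count-order ⁅ g ⁆ (Median.order m) ⟩
    ∣ ⁅ g ⁆ ∣                                            ≡⟨ ∣⁅x⁆∣≡1 g ⟩
    1                                                    ∎)
    where
    open ≤-Reasoning
    two : count (_∈? ⁅ g ⁆) (g ∷ g ∷ []) ≡ 2
    two = cong length (filter-all (_∈? ⁅ g ⁆) (x∈⁅x⁆ g ∷ x∈⁅x⁆ g ∷ []))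

  last-two-forward : ∀ M g f → Median T (M ++ g ∷ f ∷ []) → ¬ (f ⟶ g)
  last-two-forward M g f m f⟶g = <-irrefl refl (begin-strict
    0          <⟨ ≤-reflexive (sym (count-∷⁺ (f ⟶?_) {g} {[]} f⟶g)) ⟩
    d⁺ f [ g ] ≤⟨ feedback⁻ M [ g ] f [] refl m ⟩
    d⁻ f [ g ] ≡⟨ count-∷⁻ (_⟶? f) {g} {[]} (asym f⟶g) ⟩
    0          ∎)
    where open ≤-Reasoning

  -- If `x` were last and `q` stood between `v` and `x`, feedback at `x` and at `v` would give 1 +
  -- `d⁺ v q` ≤ `d⁺ x (v ∷ q)` ≤ `d⁻ x q` ≤ `d⁻ v q` ≤ `d⁺ v q`.
  dominated-not-last : ∀ {x v} → x ⟶ v → (∀ {u} → v ⟶ u → x ⟶ u) → (∀ {u} → u ≢ v → ¬ (v ⟶ u) → u ⟶ v) →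
    ¬ EndsMedian T x
  dominated-not-last {x} {v} x⟶v v≤x total (M , m) with ∈-++⁻ M (∈-resp-↭ (↭-sym (Median.order m)) (∈-allFin v))
  ... | inj₂ (here v≡x) = irrefl (sym v≡x) x⟶v
  ... | inj₁ v∈M with p , q , refl ← ∈-∃++ v∈M = <-irrefl refl (begin-strict
    d⁺ v q                   ≤⟨ count-mono (v ⟶?_) (x ⟶?_) (All.universal (λ _ → v≤x) q) ⟩
    d⁺ x q                   <⟨ ≤-reflexive (sym (count-∷⁺ (x ⟶?_) {v} {q} x⟶v)) ⟩
    d⁺ x (v ∷ q)             ≤⟨ feedback⁻ p (v ∷ q) x [] (++-assoc p (v ∷ q) [ x ]) m ⟩
    d⁻ x (v ∷ q)             ≡⟨ count-∷⁻ (_⟶? x) {v} {q} (asym x⟶v) ⟩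
    d⁻ x q                   ≤⟨ count-mono (_⟶? x) (_⟶? v) (All.universal into q) ⟩
    d⁻ v q                   ≤⟨ m≤m+n _ _ ⟩
    d⁻ v q + d⁻ v [ x ]      ≡⟨ count-++ (_⟶? v) q [ x ] ⟨
    d⁻ v (q ∷ʳ x)            ≤⟨ feedback⁺ p v (q ∷ʳ x) [] split m ⟩
    d⁺ v (q ∷ʳ x)            ≡⟨ count-++ (v ⟶?_) q [ x ] ⟩
    d⁺ v q + d⁺ v [ x ]      ≡⟨ cong (d⁺ v q +_) (count-∷⁻ (v ⟶?_) {x} {[]} (asym x⟶v)) ⟩
    d⁺ v q + 0               ≡⟨ +-identityʳ _ ⟩
    d⁺ v q                   ∎)
    where
    open ≤-Reasoning
    into : ∀ u → u ⟶ x → u ⟶ v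
    into u u⟶x = total (λ { refl → asym x⟶v u⟶x }) (λ v⟶u → asym u⟶x (v≤x v⟶u))
    split : (p ++ v ∷ q) ∷ʳ x ≡ p ++ v ∷ (q ∷ʳ x) ++ []
    split = trans (++-assoc p (v ∷ q) [ x ]) (cong (λ l → p ++ v ∷ l) (sym (++-identityʳ (q ∷ʳ x))))

-- Segments closed by vertices out of reach.

module Segments {n : ℕ} (N G : Subset n) where

  -- `N` and `G` stand for the first and second out-neighbourhoods of the last vertex f, possibly
  -- enlarged. The bad vertices are the remaining ones, f included.
  Bad : Pred (Fin n) 0ℓ
  Bad v = v ∉ N × v ∉ G

  bad? : Decidable Bad
  bad? v = ¬? (v ∈? N) ×-dec ¬? (v ∈? G)

  ∣N∣ ∣G∣ : List (Fin n) → ℕ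
  ∣N∣ = count (_∈? N)
  ∣G∣ = count (_∈? G)

  -- An order whose last vertex is bad splits into segments of vertices in N ∪ G, each closed by a bad vertex.
  sum-over-segments : (_∼_ : Rel ℕ 0ℓ) → (∀ {a b c d} → a ∼ b → c ∼ d → (a + c) ∼ (b + d)) → 0 ∼ 0 →
    ∀ {L} f → Bad f →
    (∀ pre seg v post → L ≡ pre ++ seg ++ v ∷ post → Bad v → All (λ u → ¬ Bad u) seg → ∣N∣ seg ∼ ∣G∣ seg) →
    ∀ M → L ≡ M ∷ʳ f → ∣N∣ L ∼ ∣G∣ L
  sum-over-segments _∼_ add 0∼0 {L} f f-bad each M refl = scan [] [] M [] refl
    where
    close : ∀ seg v rest → Bad v → ∣N∣ seg ∼ ∣G∣ seg → ∣N∣ rest ∼ ∣G∣ rest →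
      ∣N∣ (seg ++ v ∷ rest) ∼ ∣G∣ (seg ++ v ∷ rest)
    close seg v rest (v∉N , v∉G) p q
      rewrite count-++ (_∈? N) seg (v ∷ rest) | count-++ (_∈? G) seg (v ∷ rest)
            | count-∷⁻ (_∈? N) {v} {rest} v∉N | count-∷⁻ (_∈? G) {v} {rest} v∉G = add p q

    scan : ∀ pre seg rest → All (λ u → ¬ Bad u) seg → L ≡ pre ++ seg ++ rest ∷ʳ f →
      ∣N∣ (seg ++ rest ∷ʳ f) ∼ ∣G∣ (seg ++ rest ∷ʳ f)
    scan pre seg [] good eq = close seg f [] f-bad (each pre seg f [] eq f-bad good) 0∼0
    scan pre seg (v ∷ rest) good eq with bad? v
    ... | yes v-bad = close seg v (rest ∷ʳ f) v-bad (each pre seg v _ eq v-bad good)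
      (scan (pre ++ seg ++ [ v ]) [] rest []
        (trans eq (sym (trans (++-assoc pre (seg ++ [ v ]) _) (cong (pre ++_) (++-assoc seg [ v ] _))))))
    ... | no v-good = subst (λ l → ∣N∣ l ∼ ∣G∣ l) (++-assoc seg [ v ] (rest ∷ʳ f))
      (scan pre (seg ∷ʳ v) rest (All.∷ʳ⁺ good v-good)
        (trans eq (cong (pre ++_) (sym (++-assoc seg [ v ] (rest ∷ʳ f))))))

-- The Havet-Thomassé inequality at the last vertex.

module LastVertex {n : ℕ} (T : OrientedGraph n) (f : Fin n) (N G : Subset n)
  (f∉N : f ∉ N) (f∉G : f ∉ G) (toN : ∀ {v u} → v ∉ N → v ∉ G → u ∈ N → OrientedGraph._⟶_ T v u) where

  open OrientedGraph T
  open MedianOrders T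
  open Segments N G

  segment⁺ : ∀ v seg → Bad v → ∣N∣ seg ≤ outdeg _⟶?_ v seg
  segment⁺ v seg (v∉N , v∉G) = count-mono (_∈? N) (v ⟶?_) (All.universal (λ _ → toN v∉N v∉G) seg)

  segment⁻ : ∀ v seg → Bad v → All (λ u → ¬ Bad u) seg → indeg _⟶?_ v seg ≤ ∣G∣ seg
  segment⁻ v seg (v∉N , v∉G) good = count-mono (_⟶? v) (_∈? G) (All.map inG good)
    where
    inG : ∀ {u} → ¬ Bad u → u ⟶ v → u ∈ G
    inG {u} ¬bad u⟶v with u ∈? G
    ... | yes u∈G = u∈G
    ... | no  u∉G = contradiction ((λ u∈N → asym u⟶v (toN v∉N v∉G u∈N)) , u∉G) ¬bad

  -- On a segment closed by a bad v, feedback links the two counts: `N` there is at most the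
  -- outdegree of v, hence at most its indegree, hence at most `G`. The segments add up.
  ∣N∣≤∣G∣ : EndsMedian T f → ∣ N ∣ ≤ ∣ G ∣
  ∣N∣≤∣G∣ (M , m) = subst₂ _≤_ (count-order N order) (count-order G order)
    (sum-over-segments _≤_ +-mono-≤ z≤n f (f∉N , f∉G)
      (λ pre seg v post eq v-bad good →
        ≤-trans (segment⁺ v seg v-bad) (≤-trans (feedback⁻ pre seg v post eq m) (segment⁻ v seg v-bad good)))
      M refl)
    where open Median m

  private
    -- Strictness, with the exception that empty segments need; the exception vanishes once the left
    -- side is positive.
    _⊏_ : Rel ℕ 0ℓ
    a ⊏ b = a < b ⊎ a ≡ 0

    ⊏-add : ∀ {a b c d} → a ⊏ b → c ⊏ d → (a + c) ⊏ (b + d)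
    ⊏-add (inj₁ a<b)  (inj₁ c<d)  = inj₁ (+-mono-< a<b c<d)
    ⊏-add (inj₁ a<b)  (inj₂ refl) = inj₁ (+-mono-<-≤ a<b z≤n)
    ⊏-add (inj₂ refl) (inj₁ c<d)  = inj₁ (≤-trans c<d (m≤n+m _ _))
    ⊏-add (inj₂ refl) (inj₂ refl) = inj₂ refl

    -- Made a relation so that `forward disorder?` counts good-before-bad pairs and `forward-move`
    -- applies to them.
    Disorder : Rel (Fin n) 0ℓ
    Disorder u v = ¬ Bad u × Bad v

    disorder? : B.Decidable Disorder
    disorder? u v = ¬? (bad? u) ×-dec bad? v

    disorder-drops : ∀ pre u seg v post → Bad v → All (λ u → ¬ Bad u) (u ∷ seg) →
      forward disorder? (pre ++ v ∷ (u ∷ seg) ++ post) < forward disorder? (pre ++ (u ∷ seg) ++ v ∷ post)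
    disorder-drops pre u seg v post v-bad (u-good ∷ _) = begin-strict
      forward disorder? (pre ++ v ∷ (u ∷ seg) ++ post)
        <⟨ m<m+n _ (≤-trans (s≤s z≤n) (≤-reflexive (sym (count-∷⁺ (λ u → disorder? u v) {u} {seg} (u-good , v-bad))))) ⟩
      forward disorder? (pre ++ v ∷ (u ∷ seg) ++ post) + indeg disorder? v (u ∷ seg)
        ≡⟨ forward-move disorder? pre (u ∷ seg) v post ⟨
      forward disorder? (pre ++ (u ∷ seg) ++ v ∷ post) + outdeg disorder? v (u ∷ seg)
        ≡⟨ cong (forward disorder? (pre ++ (u ∷ seg) ++ v ∷ post) +_) (cong length (filter-none (disorder? v) {u ∷ seg} (All.universal (λ _ (v-good , _) → v-good v-bad) (u ∷ seg)))) ⟩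
      forward disorder? (pre ++ (u ∷ seg) ++ v ∷ post) + 0
        ≡⟨ +-identityʳ _ ⟩
      forward disorder? (pre ++ (u ∷ seg) ++ v ∷ post) ∎
      where open ≤-Reasoning

  -- In a median order ending in f with the fewest good-before-bad pairs, only the last segment can be
  -- balanced, and then f can be moved in front of it.
  ∣N∣<∣G∣ : 0 < ∣ N ∣ →
    (∀ M g → Median T (M ++ g ∷ f ∷ []) → EndsMedian T g → ⊥) →
    EndsMedian T f → ¬ (∣ G ∣ ≤ ∣ N ∣)
  ∣N∣<∣G∣ 0<∣N∣ last (M₀ , m₀) ∣G∣≤∣N∣ =
    no-minimum⇒empty (λ M → forward disorder? (M ∷ʳ f)) tight M₀ m₀
    where
    tight : ∀ M → Median T (M ∷ʳ f) →
      (∀ M′ → Median T (M′ ∷ʳ f) → forward disorder? (M ∷ʳ f) ≤ forward disorder? (M′ ∷ʳ f)) → ⊥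
    tight M m min = conclude (sum-over-segments _⊏_ ⊏-add (inj₂ refl) f (f∉N , f∉G) segment M refl)
      where
      open Median m
      conclude : ∣N∣ (M ∷ʳ f) ⊏ ∣G∣ (M ∷ʳ f) → ⊥
      conclude rewrite count-order N order | count-order G order = λ
        { (inj₁ N<G) → <⇒≱ N<G ∣G∣≤∣N∣
        ; (inj₂ N≡0) → <⇒≢ 0<∣N∣ (sym N≡0) }

      not-movable : ∀ pre seg → InitLast seg → seg ≢ [] →
        Median T ((pre ++ seg) ∷ʳ f) → Median T (pre ++ f ∷ seg) → ⊥
      not-movable pre .[] [] seg≢[] _ _ = seg≢[] refl
      -- The original order ends in `g`, `f` and the moved one in `g`, which `last` forbids.
      not-movable pre .(seg ∷ʳ g) (seg ∷ʳ′ g) _ m₁ m₂ = last (pre ++ seg) g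
        (subst (Median T) (trans (cong (_∷ʳ f) (sym (++-assoc pre seg [ g ]))) (++-assoc (pre ++ seg) [ g ] [ f ])) m₁)
        (pre ++ f ∷ seg , subst (Median T) (sym (++-assoc pre (f ∷ seg) [ g ])) m₂)

      unbalanced : ∀ pre u seg v post → M ∷ʳ f ≡ pre ++ (u ∷ seg) ++ v ∷ post → Bad v →
        All (λ u → ¬ Bad u) (u ∷ seg) → ¬ (indeg _⟶?_ v (u ∷ seg) ≤ outdeg _⟶?_ v (u ∷ seg))
      -- If `post` is empty, `v` is `f` itself. Otherwise the order with `v` moved still ends in
      -- `f`, and its smaller disorder contradicts `min`.
      unbalanced pre u seg v post eq v-bad good in≤out with initLast post
      ... | [] with refl , refl ← ∷ʳ-injective M (pre ++ u ∷ seg) (trans eq (sym (++-assoc pre (u ∷ seg) [ v ]))) =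
        not-movable pre (u ∷ seg) (initLast (u ∷ seg)) (λ ()) m
          (subst (λ l → Median T (pre ++ f ∷ l)) (++-identityʳ (u ∷ seg))
            (move-left pre (u ∷ seg) f [] eq m in≤out))
      ... | post′ ∷ʳ′ g with refl , refl ← ∷ʳ-injective M (pre ++ (u ∷ seg) ++ v ∷ post′)
                              (trans eq (sym (trans (++-assoc pre _ _) (cong (pre ++_) (++-assoc (u ∷ seg) _ _))))) =
        <⇒≱ (subst₂ _<_ (cong (forward disorder?) (sym moved)) (cong (forward disorder?) (sym eq))
              (disorder-drops pre u seg v (post′ ∷ʳ f) v-bad good))
            (min (pre ++ v ∷ (u ∷ seg) ++ post′)
              (subst (Median T) (sym moved) (move-left pre (u ∷ seg) v (post′ ∷ʳ f) eq m in≤out)))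
        where
        moved : (pre ++ v ∷ (u ∷ seg) ++ post′) ∷ʳ f ≡ pre ++ v ∷ (u ∷ seg) ++ post′ ∷ʳ f
        moved = trans (++-assoc pre _ _) (cong (λ l → pre ++ v ∷ l) (++-assoc (u ∷ seg) post′ [ f ]))

      segment : ∀ pre seg v post → M ∷ʳ f ≡ pre ++ seg ++ v ∷ post → Bad v → All (λ u → ¬ Bad u) seg →
        ∣N∣ seg ⊏ ∣G∣ seg
      segment pre [] v post eq v-bad good = inj₂ refl
      segment pre (u ∷ seg) v post eq v-bad good = inj₁ (begin-strict
        ∣N∣ (u ∷ seg)           ≤⟨ segment⁺ v (u ∷ seg) v-bad ⟩
        outdeg _⟶?_ v (u ∷ seg)    <⟨ ≰⇒> (unbalanced pre u seg v post eq v-bad good) ⟩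
        indeg _⟶?_ v (u ∷ seg)    ≤⟨ segment⁻ v (u ∷ seg) v-bad good ⟩
        ∣G∣ (u ∷ seg)           ∎)
        where open ≤-Reasoning

-- Subsets: cardinality of unions, membership in tabulated ones.

∣p∪q∣≤∣p∣+∣q∣ : (p q : Subset n) → ∣ p ∪ₛ q ∣ ≤ ∣ p ∣ + ∣ q ∣
∣p∪q∣≤∣p∣+∣q∣ []          []          = z≤n
∣p∪q∣≤∣p∣+∣q∣ (false ∷ p) (false ∷ q) = ∣p∪q∣≤∣p∣+∣q∣ p q
∣p∪q∣≤∣p∣+∣q∣ (false ∷ p) (true  ∷ q) = ≤-trans (s≤s (∣p∪q∣≤∣p∣+∣q∣ p q)) (≤-reflexive (sym (+-suc ∣ p ∣ ∣ q ∣)))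
∣p∪q∣≤∣p∣+∣q∣ (true  ∷ p) (false ∷ q) = s≤s (∣p∪q∣≤∣p∣+∣q∣ p q)
∣p∪q∣≤∣p∣+∣q∣ (true  ∷ p) (true  ∷ q) = s≤s (≤-trans (∣p∪q∣≤∣p∣+∣q∣ p q) (+-monoʳ-≤ ∣ p ∣ (n≤1+n ∣ q ∣)))

∈-tabulate⁺ : {P : Pred (Fin n) 0ℓ} (P? : Decidable P) → ∀ {i} → P i → i ∈ Vec.tabulate (does ∘ P?)
∈-tabulate⁺ P? {i} p = lookup⇒[]= i _ (trans (lookup∘tabulate (does ∘ P?) i) (dec-true (P? i) p))

∈-tabulate⁻ : {P : Pred (Fin n) 0ℓ} (P? : Decidable P) → ∀ {i} → i ∈ Vec.tabulate (does ∘ P?) → P i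
∈-tabulate⁻ P? {i} i∈ with P? i | trans (sym (lookup∘tabulate (does ∘ P?) i)) ([]=⇒lookup i∈)
... | yes p | _ = p

-- Offenders of inserted arcs.

module Offence {n : ℕ} (D : OrientedGraph n) where
  open OrientedGraph D

  Reach : Rel (Fin n) 0ℓ
  Reach v w = v ⟶ w ⊎ ∃[ u ] (v ⟶ u × u ⟶ w)

  reach? : B.Decidable Reach
  reach? v w = (v ⟶? w) ⊎-dec any? λ u → (v ⟶? u) ×-dec (u ⟶? w)

  -- Inserting the arc u ⟶ w would enlarge the second out-neighbourhood of v by w.
  Offends : Fin n → Fin n → Fin n → Set
  Offends v u w = v ⟶ u × v ≢ w × ¬ Reach v w

  offends? : ∀ v u w → Dec (Offends v u w)
  offends? v u w = (v ⟶? u) ×-dec ¬? (v ≟ w) ×-dec ¬? (reach? v w)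

  missing? : B.Decidable (Missing D)
  missing? u v = ¬? (u ≟ v) ×-dec ¬? (u ⟶? v) ×-dec ¬? (v ⟶? u)

  missing-sym : ∀ {u v} → Missing D u v → Missing D v u
  missing-sym = Graph.sym (missingGraph D)

  -- An arc from p to q would let p reach w through q, and one from q to p would let q reach u
  -- through p.
  opposite-offenders : ∀ {u w p q} → Offends p u w → Offends q w u → Missing D p q
  opposite-offenders (p⟶u , _ , ¬pw) (q⟶w , _ , ¬qu) =
    (λ { refl → ¬qu (inj₁ p⟶u) }) ,
    (λ p⟶q → ¬pw (inj₂ (_ , p⟶q , q⟶w))) ,
    (λ q⟶p → ¬qu (inj₂ (_ , q⟶p , p⟶u)))

  -- `E v u w` says that v is tolerated as an offender of the inserted arc from u to w.
  module _ (E : Fin n → Fin n → Fin n → Set) (E? : ∀ v u w → Dec (E v u w)) where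

    OffendsOnly : Rel (Fin n) 0ℓ
    OffendsOnly u w = ∀ v → Offends v u w → E v u w

    offendsOnly? : B.Decidable OffendsOnly
    offendsOnly? u w = all? λ v → offends? v u w →-dec E? v u w

    orientable : (∀ {u w p q} → Missing D u w → Offends p u w → ¬ E p u w → Offends q w u → ¬ E q w u → ⊥) →
      ∀ {u w} → Missing D u w → OffendsOnly u w ⊎ OffendsOnly w u
    orientable clash {u} {w} uw with any? (λ p → offends? p u w ×-dec ¬? (E? p u w))
    ... | no none = inj₁ λ p op → decidable-stable (E? p u w) λ ¬e → none (p , op , ¬e)
    ... | yes (p , op , ¬ep) = inj₂ λ q oq → decidable-stable (E? q w u) λ ¬eq → clash uw op ¬ep oq ¬eq

-- Completing `D` to a tournament.

record Completion (D : OrientedGraph n) (Q : Rel (Fin n) 0ℓ) : Set₁ where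
  private module D = OrientedGraph D
  field
    T      : OrientedGraph n
  open OrientedGraph T public
  field
    extends : ∀ {u v} → u D.⟶ v → u ⟶ v
    origin  : ∀ {u v} → u ⟶ v → u D.⟶ v ⊎ (Missing D u v × Q u v)
    total   : ∀ {u v} → u ≢ v → ¬ (u ⟶ v) → v ⟶ u

module _ (D : OrientedGraph n) {Q : Rel (Fin n) 0ℓ} (Q? : B.Decidable Q) where
  open OrientedGraph D
  open Offence D

  private
    -- Q may hold in both directions, so it is consulted for one direction only.
    Chosen : Rel (Fin n) 0ℓ
    Chosen u v = (u Fin.< v × Q u v) ⊎ (v Fin.< u × ¬ Q v u)

    chosen? : B.Decidable Chosen
    chosen? u v = (u <? v ×-dec Q? u v) ⊎-dec (v <? u ×-dec ¬? (Q? v u))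

    chosen-asym : ∀ {u v} → Chosen u v → ¬ Chosen v u
    chosen-asym (inj₁ (u<v , _)) (inj₁ (v<u , _)) = <-asym u<v v<u
    chosen-asym (inj₁ (_ , q))   (inj₂ (_ , ¬q))  = ¬q q
    chosen-asym (inj₂ (_ , ¬q))  (inj₁ (_ , q))   = ¬q q
    chosen-asym (inj₂ (v<u , _)) (inj₂ (u<v , _)) = <-asym u<v v<u

    chosen-total : ∀ {u v} → u ≢ v → ¬ Chosen u v → Chosen v u
    chosen-total {u} {v} u≢v ¬c with <-cmp u v | Q? u v | Q? v u
    ... | tri≈ _ u≡v _ | _     | _     = contradiction u≡v u≢v
    ... | tri< u<v _ _ | yes q | _     = contradiction (inj₁ (u<v , q)) ¬c
    ... | tri< u<v _ _ | no ¬q | _     = inj₂ (u<v , ¬q)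
    ... | tri> _ _ v<u | _     | yes q = inj₁ (v<u , q)
    ... | tri> _ _ v<u | _     | no ¬q = contradiction (inj₂ (v<u , ¬q)) ¬c

  complete : (∀ {u v} → Missing D u v → Q u v ⊎ Q v u) → Completion D Q
  complete Q-total = record
    { T = record
      { _⟶_    = λ u v → u ⟶ v ⊎ (Missing D u v × Chosen u v)
      ; _⟶?_   = λ u v → (u ⟶? v) ⊎-dec (missing? u v ×-dec chosen? u v)
      ; irrefl = λ { u≡v (inj₁ uv) → irrefl u≡v uv ; u≡v (inj₂ ((u≢v , _) , _)) → u≢v u≡v }
      ; asym   = λ { (inj₁ uv) (inj₁ vu) → asym uv vu
                   ; (inj₁ uv) (inj₂ ((_ , _ , ¬uv) , _)) → ¬uv uv
                   ; (inj₂ ((_ , _ , ¬vu) , _)) (inj₁ vu) → ¬vu vu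
                   ; (inj₂ (_ , c)) (inj₂ (_ , c′)) → chosen-asym c c′ }
      }
    ; extends = inj₁
    ; origin  = λ { (inj₁ uv) → inj₁ uv
                  ; (inj₂ (m , inj₁ (_ , q))) → inj₂ (m , q)
                  ; (inj₂ (m , inj₂ (_ , ¬q))) → inj₂ (m , fromInj₁ (λ q → contradiction q ¬q) (Q-total m)) }
    ; total   = tot
    }
    where
    tot : ∀ {u v} → u ≢ v → ¬ (u ⟶ v ⊎ (Missing D u v × Chosen u v)) → v ⟶ u ⊎ (Missing D v u × Chosen v u)
    tot {u} {v} u≢v ¬uv with v ⟶? u
    ... | yes vu = inj₁ vu
    ... | no ¬vu = inj₂ (missing-sym m , chosen-total u≢v (λ c → ¬uv (inj₂ (m , c))))
      where
      m : Missing D u v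
      m = u≢v , ¬uv ∘ inj₁ , ¬vu

-- Vertices that cannot end a median order of a completion.

module Ends {n : ℕ} (D : OrientedGraph n) (no-snp : ∀ v → ∣ N⁺⁺ D v ∣ < ∣ N⁺ D v ∣)
  {Q : Rel (Fin n) 0ℓ} (C : Completion D Q) where
  private module D = OrientedGraph D
  open Completion C
  open Offence D

  -- Where the second out-neighbourhood of f in a completion may exceed the one in D.
  Lost : Fin n → Pred (Fin n) 0ℓ
  Lost f w = ∃[ u ] (Q u w × Offends f u w)

  private
    ∈N⁺⇒⟶ : ∀ {f w} → w ∈ N⁺ D f → f D.⟶ w
    ∈N⁺⇒⟶ {f} = ∈-tabulate⁻ (f D.⟶?_)

    ⟶⇒∈N⁺ : ∀ {f w} → f D.⟶ w → w ∈ N⁺ D f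
    ⟶⇒∈N⁺ {f} = ∈-tabulate⁺ (f D.⟶?_)

    f∉N⁺ : ∀ {f} → f ∉ N⁺ D f
    f∉N⁺ f∈ = D.irrefl refl (∈N⁺⇒⟶ f∈)

    f∉N⁺⁺ : ∀ {f} → f ∉ N⁺⁺ D f
    f∉N⁺⁺ {f} f∈ = proj₁ (proj₂ (∈-tabulate⁻ (secondOut? D f) f∈)) refl

  unreachable : ∀ {f v} → v ≢ f → v ∉ N⁺ D f → v ∉ N⁺⁺ D f → ¬ Reach f v
  unreachable v≢f v∉N v∉NN (inj₁ fv) = v∉N (⟶⇒∈N⁺ fv)
  unreachable {f} v≢f v∉N v∉NN (inj₂ (u , fu , uv)) =
    v∉NN (∈-tabulate⁺ (secondOut? D f) ((λ fv → v∉N (⟶⇒∈N⁺ fv)) , v≢f , u , fu , uv))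

  -- If instead u dominated v, that arc would be inserted, since an arc of `D` would put v within
  -- two steps of f; then f would offend it and lose v.
  out-of-reach-dominates : ∀ {f v u} → v ∉ N⁺ D f → v ∉ N⁺⁺ D f → ¬ Lost f v → u ∈ N⁺ D f → v ⟶ u
  out-of-reach-dominates {f} {v} {u} v∉N v∉NN ¬lost u∈N with v ≟ f
  ... | yes refl = extends (∈N⁺⇒⟶ u∈N)
  ... | no v≢f with v D.⟶? u
  ...   | yes vu = extends vu
  ...   | no ¬vu = total u≢v λ u⟶v → [ ¬uv , (λ (_ , q) → ¬lost (u , q , fu , ≢-sym v≢f , ¬fv)) ]′ (origin u⟶v)
    where
    fu = ∈N⁺⇒⟶ u∈N
    ¬fv = unreachable v≢f v∉N v∉NN
    u≢v : u ≢ v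
    u≢v refl = v∉N u∈N
    ¬uv : ¬ (u D.⟶ v)
    ¬uv uv = ¬fv (inj₂ (u , fu , uv))

  lossless-not-last : ∀ {f} → (∀ {w} → ¬ Lost f w) → ¬ EndsMedian T f
  lossless-not-last {f} lossless end = <⇒≱ (no-snp f)
    (LastVertex.∣N∣≤∣G∣ T f (N⁺ D f) (N⁺⁺ D f) f∉N⁺ f∉N⁺⁺
      (λ v∉N v∉NN → out-of-reach-dominates v∉N v∉NN lossless) end)

  private
    module _ (f z : Fin n) where
      G : Subset n
      G = N⁺⁺ D f ∪ₛ ⁅ z ⁆

      ∣G∣≤1+∣N⁺⁺∣ : ∣ G ∣ ≤ suc ∣ N⁺⁺ D f ∣
      ∣G∣≤1+∣N⁺⁺∣ = ≤-trans (∣p∪q∣≤∣p∣+∣q∣ (N⁺⁺ D f) ⁅ z ⁆)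
        (≤-reflexive (trans (cong (∣ N⁺⁺ D f ∣ +_) (∣⁅x⁆∣≡1 z)) (+-comm _ 1)))

      f∉G : f ≢ z → f ∉ G
      f∉G f≢z f∈G with x∈p∪q⁻ (N⁺⁺ D f) ⁅ z ⁆ f∈G
      ... | inj₁ f∈NN = f∉N⁺⁺ f∈NN
      ... | inj₂ f∈z  = f≢z (x∈⁅y⁆⇒x≡y z f∈z)

      ∉G⇒∉N⁺⁺ : ∀ {v} → v ∉ G → v ∉ N⁺⁺ D f
      ∉G⇒∉N⁺⁺ v∉G v∈ = v∉G (x∈p∪q⁺ (inj₁ v∈))

      ∉G⇒≢ : ∀ {v} → v ∉ G → v ≢ z
      ∉G⇒≢ v∉G refl = v∉G (x∈p∪q⁺ (inj₂ (x∈⁅x⁆ z)))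

  -- Adding z to the second out-neighbourhood gives a set `G` of size at most that of `N⁺ D f`,
  -- against the strict inequality.
  one-loss-not-last : ∀ {f z} → f ≢ z → (∀ {w} → Lost f w → w ≡ z) →
    (∀ M g → Median T (M ++ g ∷ f ∷ []) → EndsMedian T g → ⊥) → ¬ EndsMedian T f
  one-loss-not-last {f} {z} f≢z only-z last end =
    LastVertex.∣N∣<∣G∣ T f (N⁺ D f) (G f z) f∉N⁺ (f∉G f z f≢z)
      (λ v∉N v∉G → out-of-reach-dominates v∉N (∉G⇒∉N⁺⁺ f z v∉G) (∉G⇒≢ f z v∉G ∘ only-z))
      (≤-trans (s≤s z≤n) (no-snp f)) last end (≤-trans (∣G∣≤1+∣N⁺⁺∣ f z) (no-snp f))

  -- The inserted arc f ⟶ x, counted as an arc out of f, makes up for the lost vertex z.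
  compensated-not-last : ∀ {f x z} → Missing D f x → f ≢ z → (∀ {w} → Lost f w → w ≡ z) → f ⟶ x →
    (∀ {v} → v ≢ x → v ≢ f → v ≢ z → ¬ Reach f v → v ⟶ x) → ¬ EndsMedian T f
  compensated-not-last {f} {x} {z} (f≢x , ¬fx , _) f≢z only-z f⟶x toX end =
    -- The vertex `x` adds one to `N`, as much as `z` can add to `G`.
    <⇒≱ (≤-trans (≤-trans (s≤s (∣G∣≤1+∣N⁺⁺∣ f z)) (s≤s (no-snp f))) N⁺<N)
      (LastVertex.∣N∣≤∣G∣ T f N (G f z) f∉N (f∉G f z f≢z) toN end)
    where
    N : Subset n
    N = N⁺ D f ∪ₛ ⁅ x ⁆

    N⁺<N : ∣ N⁺ D f ∣ < ∣ N ∣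
    N⁺<N = p⊂q⇒∣p∣<∣q∣ (p⊆p∪q ⁅ x ⁆ , x , x∈p∪q⁺ (inj₂ (x∈⁅x⁆ x)) , λ x∈ → ¬fx (∈N⁺⇒⟶ x∈))

    f∉N : f ∉ N
    f∉N f∈N with x∈p∪q⁻ (N⁺ D f) ⁅ x ⁆ f∈N
    ... | inj₁ f∈N⁺ = f∉N⁺ f∈N⁺
    ... | inj₂ f∈x  = f≢x (x∈⁅y⁆⇒x≡y x f∈x)

    toN : ∀ {v u} → v ∉ N → v ∉ G f z → u ∈ N → v ⟶ u
    toN {v} v∉N v∉G u∈N with x∈p∪q⁻ (N⁺ D f) ⁅ x ⁆ u∈N
    ... | inj₁ u∈N⁺ = out-of-reach-dominates (v∉N ∘ x∈p∪q⁺ ∘ inj₁) (∉G⇒∉N⁺⁺ f z v∉G) (∉G⇒≢ f z v∉G ∘ only-z) u∈N⁺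
    ... | inj₂ u∈x with refl ← x∈⁅y⁆⇒x≡y x u∈x | v ≟ f
    ...   | yes refl = f⟶x
    ...   | no v≢f = toX (λ { refl → v∉N u∈N }) v≢f (∉G⇒≢ f z v∉G)
      (unreachable v≢f (v∉N ∘ x∈p∪q⁺ ∘ inj₁) (∉G⇒∉N⁺⁺ f z v∉G))

-- Missing edges covered by two centres.

module TwoCentres {n : ℕ} (D : OrientedGraph n) (no-snp : ∀ v → ∣ N⁺⁺ D v ∣ < ∣ N⁺ D v ∣) where
  open OrientedGraph D
  open Offence D

  _∈ₚ_,_ : Fin n → Fin n → Fin n → Set
  z ∈ₚ u , v = u ≡ z ⊎ v ≡ z

  Covers : Fin n → Fin n → Set
  Covers x y = ∀ {u v} → Missing D u v → x ∈ₚ u , v ⊎ y ∈ₚ u , v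

  -- Keeps one centre from covering both a missing edge and the edge spanned by its opposite
  -- offenders.
  disjoint : ∀ {p q u w z} → p ⟶ u → p ≢ w → q ⟶ w → q ≢ u → z ∈ₚ u , w → ¬ (z ∈ₚ p , q)
  disjoint pu p≢w qw q≢u (inj₁ refl) (inj₁ refl) = irrefl refl pu
  disjoint pu p≢w qw q≢u (inj₁ refl) (inj₂ refl) = q≢u refl
  disjoint pu p≢w qw q≢u (inj₂ refl) (inj₁ refl) = p≢w refl
  disjoint pu p≢w qw q≢u (inj₂ refl) (inj₂ refl) = irrefl refl qw

  -- The offenders p and q of the two orientations of uw, when pq is an edge at d and uw one at c.
  Clash : Fin n → Fin n → Fin n → Fin n → Fin n → Fin n → Set
  Clash c d u w p q = c ∈ₚ u , w × d ∈ₚ p , q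

  clash : ∀ {x y u w p q} → Covers x y → Missing D u w → Offends p u w → Offends q w u →
    Clash x y u w p q ⊎ Clash y x u w p q
  clash cov uw (p⟶u , p≢w , ¬pw) (q⟶w , q≢u , ¬qu)
    with cov uw | cov (opposite-offenders (p⟶u , p≢w , ¬pw) (q⟶w , q≢u , ¬qu))
  ... | inj₁ c | inj₂ d = inj₁ (c , d)
  ... | inj₂ c | inj₁ d = inj₂ (c , d)
  ... | inj₁ c | inj₁ d = ⊥-elim (disjoint p⟶u p≢w q⟶w q≢u c d)
  ... | inj₂ c | inj₂ d = ⊥-elim (disjoint p⟶u p≢w q⟶w q≢u c d)

  -- Adjacent centres.

  module Adjacent {x y : Fin n} (cov : Covers x y) (x⟶y : x ⟶ y) where

    x≢y : x ≢ y
    x≢y x≡y = irrefl x≡y x⟶y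

    ¬y⟶x : ¬ (y ⟶ x)
    ¬y⟶x = asym x⟶y

    -- Of the eight placements of the centres, two need an arc from `y` to `x`, and in two more `x`
    -- would directly reach the `y` it must not reach.
    clash′ : ∀ {u w p q} → Missing D u w → Offends p u w → Offends q w u →
      (p ≡ y × w ≡ x) ⊎ (q ≡ y × u ≡ x) ⊎ (p ≡ x × u ≡ y) ⊎ (q ≡ x × w ≡ y)
    clash′ uw op@(p⟶u , _ , ¬pw) oq@(q⟶w , _ , ¬qu) with clash cov uw op oq
    ... | inj₁ (inj₁ refl , inj₁ refl) = contradiction p⟶u ¬y⟶x
    ... | inj₁ (inj₁ refl , inj₂ refl) = inj₂ (inj₁ (refl , refl))
    ... | inj₁ (inj₂ refl , inj₁ refl) = inj₁ (refl , refl)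
    ... | inj₁ (inj₂ refl , inj₂ refl) = contradiction q⟶w ¬y⟶x
    ... | inj₂ (inj₁ refl , inj₁ refl) = inj₂ (inj₂ (inj₁ (refl , refl)))
    ... | inj₂ (inj₁ refl , inj₂ refl) = contradiction (inj₁ x⟶y) ¬qu
    ... | inj₂ (inj₂ refl , inj₁ refl) = contradiction (inj₁ x⟶y) ¬pw
    ... | inj₂ (inj₂ refl , inj₂ refl) = inj₂ (inj₂ (inj₂ (refl , refl)))

    module Dominated (v₀ : Fin n) (v₀≢x : v₀ ≢ x) (v₀≢y : v₀ ≢ y) (¬v₀x : ¬ Reach v₀ x)
      {a : Fin n} (v₀⟶a : v₀ ⟶ a) where

      E : Fin n → Fin n → Fin n → Set
      E v u w = (v ≡ y × w ≡ x) ⊎ (v ≡ x × u ≡ y)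

      E? : ∀ v u w → Dec (E v u w)
      E? v u w = ((v ≟ y) ×-dec (w ≟ x)) ⊎-dec ((v ≟ x) ×-dec (u ≟ y))

      -- An arc into `x` is inserted only when its reverse has an offender; this keeps `v₀` and
      -- whatever it dominates from dominating `x`.
      Q : Rel (Fin n) 0ℓ
      Q u w = OffendsOnly E E? u w × (w ≡ x → ∃[ p ] Offends p x u)

      Q? : B.Decidable Q
      Q? u w = offendsOnly? E E? u w ×-dec (w ≟ x →-dec any? λ p → offends? p x u)

      no-clash : ∀ {u w p q} → Missing D u w → Offends p u w → ¬ E p u w → Offends q w u → ¬ E q w u → ⊥
      no-clash uw op ¬ep oq ¬eq with clash′ uw op oq
      ... | inj₁ e                = ¬ep (inj₁ e)
      ... | inj₂ (inj₁ e)         = ¬eq (inj₁ e)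
      ... | inj₂ (inj₂ (inj₁ e))  = ¬ep (inj₂ e)
      ... | inj₂ (inj₂ (inj₂ e))  = ¬eq (inj₂ e)

      refine : ∀ {u w} → Missing D u w → OffendsOnly E E? u w → Q u w ⊎ Q w u
      refine {u} {w} (u≢w , _) only with w ≟ x
      ... | no w≢x = inj₁ (only , λ w≡x → contradiction w≡x w≢x)
      ... | yes refl with any? (λ p → offends? p x u)
      ...   | yes p = inj₁ (only , λ _ → p)
      ...   | no ¬p = inj₂ ((λ p op → contradiction (p , op) ¬p) , λ u≡x → contradiction u≡x u≢w)

      C : Completion D Q
      C = complete D Q? λ uw → [ refine uw , swap ∘ refine (missing-sym uw) ]′ (orientable E E? no-clash uw)

      module C = Completion C
      open Ends D no-snp C

      -- Inserting this arc requires an offender p of the reverse arc. Then `v₀` and p span a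
      -- missing edge that avoids both centres.
      ¬v₀⟶x : ¬ (v₀ C.⟶ x)
      ¬v₀⟶x v₀x with C.origin v₀x
      ... | inj₁ arc = ¬v₀x (inj₁ arc)
      ... | inj₂ (_ , _ , offended) with p , p⟶x , p≢v₀ , ¬pv₀ ← offended refl
        with cov (p≢v₀ , ¬pv₀ ∘ inj₁ , (λ v₀⟶p → ¬v₀x (inj₂ (p , v₀⟶p , p⟶x))))
      ...   | inj₁ (inj₁ refl) = irrefl refl p⟶x
      ...   | inj₁ (inj₂ v₀≡x) = v₀≢x v₀≡x
      ...   | inj₂ (inj₁ refl) = ¬y⟶x p⟶x
      ...   | inj₂ (inj₂ v₀≡y) = v₀≢y v₀≡y

      -- If only the arc into `x` is inserted, `v₀` offends it without being tolerated. If the arc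
      -- from `v₀` is inserted, w must be a centre.
      ¬w⟶x : ∀ {w} → v₀ C.⟶ w → ¬ (w C.⟶ x)
      ¬w⟶x v₀w wx with C.origin v₀w | C.origin wx
      ... | inj₁ v₀⟶w | inj₁ w⟶x = ¬v₀x (inj₂ (_ , v₀⟶w , w⟶x))
      ... | inj₁ v₀⟶w | inj₂ (_ , only , _) with only v₀ (v₀⟶w , v₀≢x , ¬v₀x)
      ...   | inj₁ (v₀≡y , _) = v₀≢y v₀≡y
      ...   | inj₂ (v₀≡x , _) = v₀≢x v₀≡x
      ¬w⟶x v₀w wx | inj₂ (m , _) | _ with cov m
      ... | inj₁ (inj₁ v₀≡x) = v₀≢x v₀≡x
      ... | inj₁ (inj₂ refl) = C.irrefl refl wx
      ... | inj₂ (inj₁ v₀≡y) = v₀≢y v₀≡y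
      ... | inj₂ (inj₂ refl) = C.asym (C.extends x⟶y) wx

      x-not-last : ¬ EndsMedian C.T x
      x-not-last = MedianOrders.dominated-not-last C.T (C.total v₀≢x ¬v₀⟶x)
        (λ v₀⟶w → C.total (λ { refl → ¬v₀⟶x v₀⟶w }) (¬w⟶x v₀⟶w))
        (λ u≢v₀ → C.total (≢-sym u≢v₀))

      impossible : ⊥
      impossible = MedianOrders.some-vertex-ends C.T x not-last
        where
        others-not-last : ∀ {f} → f ≢ y → ¬ EndsMedian C.T f
        others-not-last {f} f≢y with f ≟ x
        ... | yes refl = x-not-last
        ... | no f≢x = lossless-not-last λ (_ , (only , _) , off) →
          [ (λ (f≡y , _) → f≢y f≡y) , (λ (f≡x , _) → f≢x f≡x) ]′ (only f off)

        y-loses-x : ∀ {w} → Lost y w → w ≡ x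
        y-loses-x (_ , (only , _) , off) with only y off
        ... | inj₁ (_ , w≡x) = w≡x
        ... | inj₂ (y≡x , _) = contradiction (sym y≡x) x≢y

        not-last : ∀ f → ¬ EndsMedian C.T f
        not-last f with f ≟ y
        ... | no f≢y = others-not-last f≢y
        -- The next-to-last vertex differs from `y`, so it is already known not to end a median
        -- order.
        ... | yes refl = one-loss-not-last (≢-sym x≢y) y-loses-x
          λ M g m → others-not-last (MedianOrders.last-two-distinct C.T M g y m)

    module Undominated (only-y : ∀ {a v} → Missing D a x → Offends v a x → v ≡ y) where

      -- In the second alternative the offender and `x` offend opposite orientations of one edge, so
      -- they span a missing edge, whose arc into `x` later compensates.
      E : Fin n → Fin n → Fin n → Set
      E v u w = (v ≡ y × w ≡ x) ⊎ (w ≡ y × Offends x y u)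

      E? : ∀ v u w → Dec (E v u w)
      E? v u w = ((v ≟ y) ×-dec (w ≟ x)) ⊎-dec ((w ≟ y) ×-dec offends? x y u)

      Q : Rel (Fin n) 0ℓ
      Q u w = u ≢ x × OffendsOnly E E? u w

      Q? : B.Decidable Q
      Q? u w = ¬? (u ≟ x) ×-dec offendsOnly? E E? u w

      no-clash : ∀ {u w p q} → Missing D u w → Offends p u w → ¬ E p u w → Offends q w u → ¬ E q w u → ⊥
      no-clash uw op ¬ep oq ¬eq with clash′ uw op oq
      ... | inj₁ e                             = ¬ep (inj₁ e)
      ... | inj₂ (inj₁ e)                      = ¬eq (inj₁ e)
      ... | inj₂ (inj₂ (inj₁ (refl , refl)))   = ¬eq (inj₂ (refl , op))
      ... | inj₂ (inj₂ (inj₂ (refl , refl)))   = ¬ep (inj₂ (refl , oq))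

      into-x : ∀ {u} → Missing D u x → Q u x
      into-x ux@(u≢x , _) = u≢x , λ v off → inj₁ (only-y ux off , refl)

      Q-total : ∀ {u w} → Missing D u w → Q u w ⊎ Q w u
      Q-total {u} {w} uw with u ≟ x | w ≟ x
      ... | yes refl | _        = inj₂ (into-x (missing-sym uw))
      ... | no _     | yes refl = inj₁ (into-x uw)
      ... | no u≢x   | no w≢x   with orientable E E? no-clash uw
      ...   | inj₁ only = inj₁ (u≢x , only)
      ...   | inj₂ only = inj₂ (w≢x , only)

      C : Completion D Q
      C = complete D Q? Q-total

      module C = Completion C
      open Ends D no-snp C

      missing-into-x : ∀ {u} → Missing D x u → u C.⟶ x
      missing-into-x (x≢u , ¬xu , _) = C.total x≢u λ x⟶u →
        [ ¬xu , (λ (_ , x≢x , _) → x≢x refl) ]′ (C.origin x⟶u)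

      -- f ⟶ b and x ⟶ y are such that the arc b ⟶ y loses y at f.
      compensated : ∀ {f b} → f ≢ y → Offends f b y → Offends x y b → ¬ EndsMedian C.T f
      compensated {f} {b} f≢y fby@(f⟶b , _ , ¬fy) xyb@(_ , x≢b , ¬xb) =
        compensated-not-last fx f≢y lost (missing-into-x (missing-sym fx)) toX
        where
        fx : Missing D f x
        fx = opposite-offenders fby xyb

        lost : ∀ {w} → Lost f w → w ≡ y
        lost (_ , (_ , only) , off) with only f off
        ... | inj₁ (f≡y , _) = contradiction f≡y f≢y
        ... | inj₂ (w≡y , _) = w≡y

        toX : ∀ {v} → v ≢ x → v ≢ f → v ≢ y → ¬ Reach f v → v C.⟶ x
        toX {v} v≢x v≢f v≢y ¬fv with v ⟶? x
        ... | yes vx = C.extends vx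
        ... | no ¬vx with x ⟶? v
        ...   | no ¬xv = missing-into-x (≢-sym v≢x , ¬xv , ¬vx)
        -- This case is void: `v` and `b` would span a missing edge that avoids both centres.
        ...   | yes xv with cov {v} {b} ((λ { refl → ¬fv (inj₁ f⟶b) })
                                , (λ vb → ¬xb (inj₂ (v , xv , vb))) , (λ bv → ¬fv (inj₂ (b , f⟶b , bv))))
        ...     | inj₁ (inj₁ v≡x) = contradiction v≡x v≢x
        ...     | inj₁ (inj₂ b≡x) = contradiction (sym b≡x) x≢b
        ...     | inj₂ (inj₁ v≡y) = contradiction v≡y v≢y
        ...     | inj₂ (inj₂ refl) = contradiction (inj₁ f⟶b) ¬fy

      impossible : ⊥
      impossible = MedianOrders.some-vertex-ends C.T x not-last
        where
        others-not-last : ∀ {f} → f ≢ y → ¬ EndsMedian C.T f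
        others-not-last {f} f≢y with any? (λ b → offends? f b y ×-dec offends? x y b)
        ... | yes (b , fby , xyb) = compensated f≢y fby xyb
        ... | no none = lossless-not-last λ (b , (_ , only) , off) → lossless off (only f off)
          where
          lossless : ∀ {b w} → Offends f b w → E f b w → ⊥
          lossless off (inj₁ (f≡y , _))     = f≢y f≡y
          lossless off (inj₂ (refl , xyb)) = none (_ , off , xyb)

        y-loses-x : ∀ {w} → Lost y w → w ≡ x
        y-loses-x (_ , (_ , only) , off@(_ , y≢w , _)) with only y off
        ... | inj₁ (_ , w≡x) = w≡x
        ... | inj₂ (w≡y , _) = contradiction (sym w≡y) y≢w

        not-last : ∀ f → ¬ EndsMedian C.T f
        not-last f with f ≟ y
        ... | no f≢y = others-not-last f≢y
        ... | yes refl = one-loss-not-last (≢-sym x≢y) y-loses-x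
          λ M g m → others-not-last (MedianOrders.last-two-distinct C.T M g y m)

    impossible : ⊥
    impossible with any? (λ v → any? (λ a → missing? a x ×-dec offends? v a x ×-dec ¬? (v ≟ y)))
    ... | yes (v , a , _ , (v⟶a , v≢x , ¬vx) , v≢y) = Dominated.impossible v v≢x v≢y ¬vx v⟶a
    ... | no none = Undominated.impossible λ {a} {v} ax off → decidable-stable (v ≟ y)
      λ v≢y → none (v , a , ax , off , v≢y)

  -- Non-adjacent centres.

  module NonAdjacent {x y : Fin n} (cov : Covers x y) (x≢y : x ≢ y) (¬xy : ¬ (x ⟶ y)) (¬yx : ¬ (y ⟶ x)) where

    E : Fin n → Fin n → Fin n → Set
    E v u w = (v ≡ y × w ≡ x) ⊎ (v ≡ x × w ≡ y)

    E? : ∀ v u w → Dec (E v u w)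
    E? v u w = ((v ≟ y) ×-dec (w ≟ x)) ⊎-dec ((v ≟ x) ×-dec (w ≟ y))

    Q : Rel (Fin n) 0ℓ
    Q = OffendsOnly E E?

    no-clash : ∀ {u w p q} → Missing D u w → Offends p u w → ¬ E p u w → Offends q w u → ¬ E q w u → ⊥
    -- Either the centres would be adjacent, or one centre offends an arc into the other, which `E`
    -- tolerates.
    no-clash uw op@(p⟶u , _) ¬ep oq@(q⟶w , _) ¬eq with clash cov uw op oq
    ... | inj₁ (inj₁ refl , inj₁ refl) = ¬yx p⟶u
    ... | inj₁ (inj₁ refl , inj₂ refl) = ¬eq (inj₁ (refl , refl))
    ... | inj₁ (inj₂ refl , inj₁ refl) = ¬ep (inj₁ (refl , refl))
    ... | inj₁ (inj₂ refl , inj₂ refl) = ¬yx q⟶w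
    ... | inj₂ (inj₁ refl , inj₁ refl) = ¬xy p⟶u
    ... | inj₂ (inj₁ refl , inj₂ refl) = ¬eq (inj₂ (refl , refl))
    ... | inj₂ (inj₂ refl , inj₁ refl) = ¬ep (inj₂ (refl , refl))
    ... | inj₂ (inj₂ refl , inj₂ refl) = ¬xy q⟶w

    C : Completion D Q
    C = complete D (offendsOnly? E E?) (orientable E E? no-clash)

    module C = Completion C
    open Ends D no-snp C

    lossless : ∀ {f} → f ≢ x → f ≢ y → ¬ EndsMedian C.T f
    lossless {f} f≢x f≢y = lossless-not-last λ (_ , only , off) →
      [ (λ (f≡y , _) → f≢y f≡y) , (λ (f≡x , _) → f≢x f≡x) ]′ (only f off)

    x-loses-y : ∀ {w} → Lost x w → w ≡ y
    x-loses-y (_ , only , off) with only x off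
    ... | inj₁ (x≡y , _) = contradiction x≡y x≢y
    ... | inj₂ (_ , w≡y) = w≡y

    y-loses-x : ∀ {w} → Lost y w → w ≡ x
    y-loses-x (_ , only , off) with only y off
    ... | inj₁ (_ , w≡x) = w≡x
    ... | inj₂ (y≡x , _) = contradiction (sym y≡x) x≢y

    -- The arc t ⟶ s keeps s from preceding t at the end of a median order, which settles t; then s is settled too.
    neither-last : ∀ {s t} → s ≢ t → (∀ {f} → f ≢ s → f ≢ t → ¬ EndsMedian C.T f) →
      (∀ {w} → Lost s w → w ≡ t) → (∀ {w} → Lost t w → w ≡ s) → t C.⟶ s → ∀ f → ¬ EndsMedian C.T f
    neither-last {s} {t} s≢t others s-loses-t t-loses-s t⟶s = not-last
      where
      t-not-last : ¬ EndsMedian C.T t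
      t-not-last = one-loss-not-last (≢-sym s≢t) t-loses-s λ M g m → others
        (λ { refl → MedianOrders.last-two-forward C.T M s t m t⟶s })
        (MedianOrders.last-two-distinct C.T M g t m)

      not-s-not-last : ∀ {f} → f ≢ s → ¬ EndsMedian C.T f
      not-s-not-last {f} f≢s with f ≟ t
      ... | yes refl = t-not-last
      ... | no f≢t = others f≢s f≢t

      not-last : ∀ f → ¬ EndsMedian C.T f
      not-last f with f ≟ s
      ... | no f≢s = not-s-not-last f≢s
      ... | yes refl = one-loss-not-last s≢t s-loses-t
        λ M g m → not-s-not-last (MedianOrders.last-two-distinct C.T M g s m)

    impossible : ⊥
    impossible with y C.⟶? x
    ... | yes yx = MedianOrders.some-vertex-ends C.T x
      (neither-last x≢y lossless x-loses-y y-loses-x yx)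
    ... | no ¬yx = MedianOrders.some-vertex-ends C.T x
      (neither-last (≢-sym x≢y) (λ f≢y f≢x → lossless f≢x f≢y) y-loses-x x-loses-y (C.total (≢-sym x≢y) ¬yx))

  impossible : ∀ {x y} → x ≢ y → Covers x y → ⊥
  impossible {x} {y} x≢y cov with x ⟶? y | y ⟶? x
  ... | yes xy | _      = Adjacent.impossible cov xy
  ... | no _   | yes yx = Adjacent.impossible (swap ∘ cov) yx
  ... | no ¬xy | no ¬yx = NonAdjacent.impossible cov x≢y ¬xy ¬yx

theorem3p1 : ∀ (n : ℕ) (D : OrientedGraph n) (x y : Fin n) (A B : Subset n) (x∉A : x ∉ A) (y∉B : y ∉ B)
    → x ≢ y
    → missingGraph D ≐ (star x A x∉A ∪ star y B y∉B)
    → ∃[ v ] ∣ N⁺ D v ∣ ≤ ∣ N⁺⁺ D v ∣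
theorem3p1 n D x y A B x∉A y∉B x≢y (_ , missing⊆stars , _) with any? (λ v → ∣ N⁺ D v ∣ ≤? ∣ N⁺⁺ D v ∣)
... | yes snp = snp
... | no ¬snp = ⊥-elim (TwoCentres.impossible D (λ v → ≰⇒> λ snp → ¬snp (v , snp)) x≢y cover)
  where
  cover : TwoCentres.Covers D (λ v → ≰⇒> λ snp → ¬snp (v , snp)) x y
  cover uv with missing⊆stars uv
  ... | inj₁ (inj₁ (u≡x , _)) = inj₁ (inj₁ u≡x)
  ... | inj₁ (inj₂ (_ , v≡x)) = inj₁ (inj₂ v≡x)
  ... | inj₂ (inj₁ (u≡y , _)) = inj₂ (inj₁ u≡y)
  ... | inj₂ (inj₂ (_ , v≡y)) = inj₂ (inj₂ v≡y)
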